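{- For every integer $n\ge1$, $\textsc{bm}(n,n,n)=\lceil n/2\rceil$.
   Context: A hypergraph is identified with its finite edge set; a matching is a set of pairwise disjoint edges. A hypergraph $H$ is $k$-partite with sides $V_1,\ldots,V_k$ (a fixed partition of its vertex set) if $|e\cap V_t|=1$ for every edge $e$ and every $t$. For $f:H\to\mathbb{R}_{\ge0}$, $\deg_f(v)=\sum_{e\ni v}f(e)$; $f$ is balanced if $\deg_f$ is constant on each side. $H$ is $(b_1,\ldots,b_k)$-fractionally balanced if it is $k$-partite with sides of sizes $b_1,\ldots,b_k$ and has a nonzero balanced $f:H\to\mathbb{R}_{\ge0}$. $\textsc{bm}(b_1,\ldots,b_k)$ is the largest $m$ such that every $(b_1,\ldots,b_k)$-fractionally balanced $k$-partite hypergraph has a matching of size $m$.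
   Formalization: The balanced weight function f takes nonnegative rational values instead of nonnegative real values; since balance is a homogeneous linear system with integer coefficients, the same hypergraphs are fractionally balanced, but this equivalence is not proved. -}

module Defs where

open import Data.Nat using (ℕ; _≤_)
open import Data.Fin using (Fin; zero; suc; _≟_)
open import Data.List using (List; allFin; cartesianProduct; map; concatMap; foldr)
open import Data.Product using (Σ; _×_; _,_; ∃-syntax)
open import Data.Bool using (Bool; true; false)
open import Data.Rational using (ℚ; 0ℚ; _+_; _≤_)
open import Relation.Nullary using (¬_; does)
open import Relation.Binary.PropositionalEquality using (_≡_; _≢_)

-- The vertex set of a 3-partite hypergraph with sides of sizes (n,n,n) is
-- V₁ ⊎ V₂ ⊎ V₃ with each Vₜ a copy of Fin n.  Since every edge meets every
-- side in exactly one vertex, an edge is determined by the triple of its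
-- vertices in V₁, V₂, V₃.
Edge : ℕ → Set
Edge n = Fin n × Fin n × Fin n

vertexIn : ∀ {n} → Fin 3 → Edge n → Fin n
vertexIn zero (a , b , c) = a
vertexIn (suc zero) (a , b , c) = b
vertexIn (suc (suc zero)) (a , b , c) = c

allEdges : (n : ℕ) → List (Edge n)
allEdges n = concatMap (λ a → concatMap (λ b → map (λ c → (a , b , c)) (allFin n)) (allFin n)) (allFin n)

Hypergraph : ℕ → Set
Hypergraph n = Edge n → Bool

sumℚ : List ℚ → ℚ
sumℚ = foldr _+_ 0ℚ

-- deg_f(v) for the vertex v of side t: sum of f(e) over edges e ∋ v.
-- (f is required to vanish outside H, so summing over all triples is the
-- same as summing over the edges of H.)
deg : ∀ {n} → (Edge n → ℚ) → Fin 3 → Fin n → ℚ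
deg {n} f t v = sumℚ (map (λ e → if′ (does (vertexIn t e ≟ v)) (f e)) (allEdges n))
  where
  if′ : Bool → ℚ → ℚ
  if′ true q = q
  if′ false q = 0ℚ

IsWeighting : ∀ {n} → Hypergraph n → (Edge n → ℚ) → Set
IsWeighting H f = (∀ e → 0ℚ Data.Rational.≤ f e) × (∀ e → H e ≡ false → f e ≡ 0ℚ)

Balanced : ∀ {n} → (Edge n → ℚ) → Set
Balanced {n} f = ∀ (t : Fin 3) (v w : Fin n) → deg f t v ≡ deg f t w

FractionallyBalanced : ∀ {n} → Hypergraph n → Set
FractionallyBalanced {n} H =
  Σ (Edge n → ℚ) λ f → IsWeighting H f × Balanced f × (∃[ e ] f e ≢ 0ℚ)

Disjoint : ∀ {n} → Edge n → Edge n → Set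
Disjoint e e′ = ∀ (t : Fin 3) → vertexIn t e ≢ vertexIn t e′

HasMatchingOfSize : ∀ {n} → Hypergraph n → ℕ → Set
HasMatchingOfSize {n} H m =
  Σ (Fin m → Edge n) λ M →
    (∀ i → H (M i) ≡ true) × (∀ i j → i ≢ j → Disjoint (M i) (M j))

AllHaveMatching : ℕ → ℕ → Set
AllHaveMatching n m = ∀ (H : Hypergraph n) → FractionallyBalanced H → HasMatchingOfSize H m

IsBM : ℕ → ℕ → Set
IsBM n m = AllHaveMatching n m × (∀ m′ → AllHaveMatching n m′ → m′ Data.Nat.≤ m)

{-# OPTIONS --safe #-}

-- Lower bound.  A balanced weighting has the same degree D on all three sides
-- and total weight nD.  More generally, weights with all degrees at most D and
-- total at least mD force a matching of size ⌈m/2⌉, by induction on the number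
-- of edges.  If some edge e has at most 2D of weight on the edges meeting it
-- (e included), take e and discard those edges.  A vertex with at most two
-- edges yields such an e, namely its heaviest edge: the weight meeting e is at
-- most 2x(e) + D + D - 2x(e).  Otherwise all vertices in use have at least three
-- edges, so there are at most as many of them as edges; since the degree
-- equations are dependent (each side has the same degree sum), a nonzero
-- perturbation preserves all degrees, and moving along it until a weight
-- vanishes removes an edge without changing the degrees or the total.
--
-- Upper bound.  ⌊n/2⌋ disjoint truncated Fano planes, plus one edge if n is odd.

module Submission where

open import Defs
open import Defs
import Algebra.Properties.CommutativeMonoid.Sum as CMSum
import Algebra.Properties.Semiring.Sum as SemiringSum
open import Algebra.Bundles using (CommutativeMonoid; CommutativeRing)
open import Data.Bool using (Bool; true; false; if_then_else_; not; _xor_)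
import Data.Bool.Properties as 𝔹P
open import Data.Nat as ℕ using (ℕ; zero; suc; _≤_; z≤n; s≤s; ⌈_/2⌉)
import Data.Nat.Properties as ℕP
open import Data.Fin using (Fin; zero; suc; punchIn; punchOut; _≟_)
open import Data.Fin.Properties using (injective⇒≤; suc-injective; any?; all?; punchIn-punchOut; ¬∀⟶∃¬)
open import Data.Rational as ℚ using (ℚ; 0ℚ; 1ℚ; _+_; _*_; _-_; -_; 1/_) renaming (_≤_ to _≤ℚ_; _<_ to _<ℚ_)
import Data.Rational.Properties as ℚP
open import Data.Rational.Solver using (module +-*-Solver)
open import Data.Product using (Σ; _×_; _,_; ∃; ∃-syntax; proj₁; proj₂)
open import Data.Sum using (_⊎_; inj₁; inj₂)
open import Data.List using (List; []; _∷_; concatMap; filter; allFin; tabulate; length; lookup; map; _++_)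
open import Data.List.Properties using (filter-notAll; length-map; length-++; map-cong; map-∘; map-++)
open import Data.List.Membership.Propositional using (_∈_; lose)
open import Data.List.Membership.Propositional.Properties using (∈-filter⁺; ∈-allFin; ∈-map⁺; ∈-concatMap⁺; ∈-++⁺ˡ; ∈-++⁺ʳ)
open import Data.List.Relation.Unary.Any using (index)
open import Data.List.Relation.Unary.Any.Properties using (lookup-index)
open import Function using (_∘_; id; flip; case_of_)
open import Level using (0ℓ)
open import Relation.Nullary using (¬_; Dec; yes; no; does; contradiction; ¬?)
open import Relation.Nullary.Decidable using (decidable-stable; dec-true; dec-false)
open import Relation.Unary using (Pred; Decidable)
open import Relation.Binary.Core using (Rel)
open import Relation.Binary.Definitions using (Reflexive; Transitive; Total)
open import Relation.Binary.PropositionalEquality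

-- Finite sums and extrema.

module ℚSum = SemiringSum (CommutativeRing.semiring ℚP.+-*-commutativeRing)
module ℕSum = CMSum ℕP.+-0-commutativeMonoid
open import Algebra.Definitions.RawMonoid ℚ.+-0-rawMonoid using () renaming (_×_ to _×ℚ_)

module FibreSum {a ℓ} (M : CommutativeMonoid a ℓ) where
  open CommutativeMonoid M renaming (Carrier to C; refl to ≈-refl; sym to ≈-sym; trans to ≈-trans)
  open CMSum M renaming (sum to ∑)

  sum-at : ∀ {n} (w : Fin n) (q : C) → ∑ (λ v → if does (w ≟ v) then q else ε) ≈ q
  sum-at {suc n} zero q = ≈-trans (∙-congˡ (sum-replicate-zero n)) (identityʳ q)
  sum-at (suc w) q = ≈-trans (identityˡ _) (sum-at w q)

  -- After exchanging the sums, index `j` is counted once, at `v = s j`. With `s` the vertex map of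
  -- a side, this says that the degrees on that side add up to the total weight.
  sum-fibres : ∀ {k n} (s : Fin k → Fin n) (x : Fin k → C) →
               ∑ (λ v → ∑ (λ j → if does (s j ≟ v) then x j else ε)) ≈ ∑ x
  sum-fibres s x = ≈-trans (∑-comm (λ v j → if does (s j ≟ v) then x j else ε)) (sum-cong-≋ (λ j → sum-at (s j) (x j)))

open ℚSum using (sum; sum-cong-≗; sum-remove; ∑-distrib-+; *-distribˡ-sum; sum-replicate; sum-replicate-zero)
open FibreSum ℚP.+-0-commutativeMonoid using (sum-at; sum-fibres)

sum-mono : ∀ {k} {f g : Fin k → ℚ} → (∀ j → f j ≤ℚ g j) → sum f ≤ℚ sum g
sum-mono {zero} f≤g = ℚP.≤-refl
sum-mono {suc k} f≤g = ℚP.+-mono-≤ (f≤g zero) (sum-mono (f≤g ∘ suc))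

sum-nonneg : ∀ {k} {f : Fin k → ℚ} → (∀ j → 0ℚ ≤ℚ f j) → 0ℚ ≤ℚ sum f
sum-nonneg {k} {f} 0≤f = subst (_≤ℚ sum f) (sum-replicate-zero k) (sum-mono 0≤f)

term≤sum : ∀ {k} {f : Fin k → ℚ} → (∀ j → 0ℚ ≤ℚ f j) → ∀ i → f i ≤ℚ sum f
term≤sum {suc k} {f} 0≤f i = begin
  f i                              ≡⟨ ℚP.+-identityʳ (f i) ⟨
  f i + 0ℚ                         ≤⟨ ℚP.+-monoʳ-≤ (f i) (sum-nonneg (0≤f ∘ punchIn i)) ⟩
  f i + sum (f ∘ punchIn i)        ≡⟨ sum-remove f ⟨
  sum f                            ∎
  where open ℚP.≤-Reasoning

sum-drop-zero : ∀ {k} (f : Fin (suc k) → ℚ) i → f i ≡ 0ℚ → sum (f ∘ punchIn i) ≡ sum f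
sum-drop-zero f i fi≡0 =
  sym (trans (sum-remove f) (trans (cong (_+ sum (f ∘ punchIn i)) fi≡0) (ℚP.+-identityˡ _)))

if-nonneg : ∀ b {q} → 0ℚ ≤ℚ q → 0ℚ ≤ℚ (if b then q else 0ℚ)
if-nonneg true  0≤q = 0≤q
if-nonneg false 0≤q = ℚP.≤-refl

if-mono : ∀ {a} {A : Set a} (d : Dec A) {p q} → (A → p ≤ℚ q) →
          (if does d then p else 0ℚ) ≤ℚ (if does d then q else 0ℚ)
if-mono (yes a) p≤q = p≤q a
if-mono (no _)  p≤q = ℚP.≤-refl

if-zero : ∀ b {q} → q ≡ 0ℚ → (if b then q else 0ℚ) ≡ 0ℚ
if-zero true  q≡0 = q≡0
if-zero false q≡0 = refl

if-linear : ∀ b p t q → (if b then p + t * q else 0ℚ) ≡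
                        (if b then p else 0ℚ) + t * (if b then q else 0ℚ)
if-linear true  p t q = refl
if-linear false p t q = sym (trans (ℚP.+-identityˡ _) (ℚP.*-zeroʳ t))

if-* : ∀ b q → (if b then 1ℚ else 0ℚ) * q ≡ (if b then q else 0ℚ)
if-* true  q = ℚP.*-identityˡ q
if-* false q = ℚP.*-zeroˡ q

sum-linear : ∀ {k} (f g : Fin k → ℚ) t → sum (λ j → f j + t * g j) ≡ sum f + t * sum g
sum-linear f g t =
  trans (∑-distrib-+ f (λ j → t * g j)) (cong (sum f +_) (sym (*-distribˡ-sum t g)))

-- The order is a parameter because both ends are used: the least ratio in `shift-to-boundary` and,
-- with the order flipped, the heaviest edge at a vertex.
extremum : ∀ {a ℓ} {A : Set a} {_≼_ : Rel A ℓ} → Reflexive _≼_ → Transitive _≼_ → Total _≼_ →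
           ∀ {k p} (g : Fin k → A) {P : Pred (Fin k) p} → Decidable P → ∃ P →
           ∃[ i ] P i × (∀ j → P j → g i ≼ g j)
extremum ≼-refl ≼-trans ≼-total {suc k} g {P} P? (i₀ , Pi₀) with any? (P? ∘ suc)
... | no none = zero , P0 i₀ Pi₀ , λ where
        zero    _  → ≼-refl
        (suc j) Pj → contradiction (j , Pj) none
  where
  P0 : ∀ i → P i → P zero
  P0 zero    Pi = Pi
  P0 (suc i) Pi = contradiction (i , Pi) none
... | yes some with extremum ≼-refl ≼-trans ≼-total (g ∘ suc) (P? ∘ suc) some | P? zero
...   | i , Pi , least | no ¬P0 = suc i , Pi , λ where
          zero    P0 → contradiction P0 ¬P0
          (suc j) Pj → least j Pj
...   | i , Pi , least | yes P0 with ≼-total (g zero) (g (suc i))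
...     | inj₂ gi≼g0 = suc i , Pi , λ where
            zero    _  → gi≼g0
            (suc j) Pj → least j Pj
...     | inj₁ g0≼gi = zero , P0 , λ where
            zero    _  → ≼-refl
            (suc j) Pj → ≼-trans g0≼gi (least j Pj)

-- Linear algebra and the ratio test over the rationals.

*-nonneg : ∀ {p q} → 0ℚ ≤ℚ p → 0ℚ ≤ℚ q → 0ℚ ≤ℚ p * q
*-nonneg {p} {q} 0≤p 0≤q = subst (_≤ℚ p * q) (ℚP.*-zeroʳ p)
  (ℚP.*-monoˡ-≤-nonNeg p {{ℚ.nonNegative 0≤p}} 0≤q)

*-zero-cancel : ∀ {p q} → p ≢ 0ℚ → p * q ≡ 0ℚ → q ≡ 0ℚ
*-zero-cancel {p} {q} p≢0 pq≡0 = begin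
  q                  ≡⟨ ℚP.*-identityˡ q ⟨
  1ℚ * q             ≡⟨ cong (_* q) (ℚP.*-inverseˡ p) ⟨
  1/ p * p * q       ≡⟨ ℚP.*-assoc (1/ p) p q ⟩
  1/ p * (p * q)     ≡⟨ cong (1/ p *_) pq≡0 ⟩
  1/ p * 0ℚ          ≡⟨ ℚP.*-zeroʳ (1/ p) ⟩
  0ℚ                 ∎
  where
  open ≡-Reasoning
  instance _ = ℚ.≢-nonZero p≢0

-- Gaussian elimination on the first column. If the column vanishes, the first unit vector works;
-- otherwise a pivot row `r` clears it from the other rows by cross-multiplication, and the smaller
-- system is solved recursively.
kernel-vector : ∀ k m (A : Fin m → Fin k → ℚ) → m ℕ.< k →
                Σ (Fin k → ℚ) λ c → (∃[ j ] c j ≢ 0ℚ) × (∀ i → sum (λ j → A i j * c j) ≡ 0ℚ)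
kernel-vector (suc k) m A m<k with any? (λ i → ¬? (A i zero ℚP.≟ 0ℚ))
... | no none = c , (zero , λ ()) , λ i → begin
    A i zero * 1ℚ + sum (λ j → A i (suc j) * 0ℚ)
      ≡⟨ cong₂ _+_ (trans (ℚP.*-identityʳ _) (column-zero i)) (sum-cong-≗ (λ j → ℚP.*-zeroʳ (A i (suc j)))) ⟩
    0ℚ + sum {k} (λ _ → 0ℚ)  ≡⟨ ℚP.+-identityˡ _ ⟩
    sum {k} (λ _ → 0ℚ)       ≡⟨ sum-replicate-zero k ⟩
    0ℚ ∎
  where
  open ≡-Reasoning
  c : Fin (suc k) → ℚ
  c zero    = 1ℚ
  c (suc _) = 0ℚ
  column-zero : ∀ i → A i zero ≡ 0ℚ
  column-zero i = decidable-stable (A i zero ℚP.≟ 0ℚ) (λ Ai≢0 → none (i , Ai≢0))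
kernel-vector (suc k) (suc m) A (s≤s m<k) | yes (r , p≢0) =
  c , (suc (proj₁ nonzero) , λ eq → proj₂ nonzero (*-zero-cancel p≢0 eq)) , row
  where
  open ≡-Reasoning
  p = A r zero
  A′ : Fin m → Fin k → ℚ
  A′ i j = p * A (punchIn r i) (suc j) + (- A (punchIn r i) zero) * A r (suc j)
  rec = kernel-vector k m A′ m<k
  c′ = proj₁ rec
  nonzero = proj₁ (proj₂ rec)
  σ = sum (λ j → A r (suc j) * c′ j)
  c : Fin (suc k) → ℚ
  -- The pivot row forces this coordinate once the others are the recursive solution scaled by `p`.
  c zero    = - σ
  c (suc j) = p * c′ j

  pull-p : ∀ i → sum (λ j → A i (suc j) * (p * c′ j)) ≡ p * sum (λ j → A i (suc j) * c′ j)
  pull-p i = trans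
    (sum-cong-≗ (λ j → solve 3 (λ a b d → a :* (b :* d) := b :* (a :* d)) refl (A i (suc j)) p (c′ j)))
    (sym (*-distribˡ-sum p (λ j → A i (suc j) * c′ j)))
    where open +-*-Solver

  eliminated : ∀ i → p * sum (λ j → A (punchIn r i) (suc j) * c′ j) + (- A (punchIn r i) zero) * σ ≡ 0ℚ
  eliminated i = begin
    p * sum (λ j → a j * c′ j) + b * σ
      ≡⟨ cong (_+ b * σ) (*-distribˡ-sum p (λ j → a j * c′ j)) ⟩
    sum (λ j → p * (a j * c′ j)) + b * σ
      ≡⟨ sum-linear (λ j → p * (a j * c′ j)) (λ j → A r (suc j) * c′ j) b ⟨
    sum (λ j → p * (a j * c′ j) + b * (A r (suc j) * c′ j))
      ≡⟨ sum-cong-≗ (λ j → solve 5 (λ p a b d e → p :* (a :* e) :+ b :* (d :* e) := (p :* a :+ b :* d) :* e)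
                             refl p (a j) b (A r (suc j)) (c′ j)) ⟩
    sum (λ j → A′ i j * c′ j)  ≡⟨ proj₂ (proj₂ rec) i ⟩
    0ℚ ∎
    where
    open +-*-Solver
    a = λ j → A (punchIn r i) (suc j)
    b = - A (punchIn r i) zero

  row : ∀ i → sum (λ j → A i j * c j) ≡ 0ℚ
  row i with r ≟ i
  ... | yes refl = trans (cong (p * - σ +_) (pull-p r))
                         (solve 2 (λ p s → p :* (:- s) :+ p :* s := con 0ℚ) refl p σ)
    where open +-*-Solver
  ... | no r≢i with punchOut r≢i | punchIn-punchOut r≢i
  ...   | i′ | refl = begin
    A i zero * - σ + sum (λ j → A i (suc j) * (p * c′ j))
      ≡⟨ cong (A i zero * - σ +_) (pull-p i) ⟩
    A i zero * - σ + p * sum (λ j → A i (suc j) * c′ j)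
      ≡⟨ solve 3 (λ a s q → a :* (:- s) :+ q := q :+ (:- a) :* s) refl (A i zero) σ _ ⟩
    p * sum (λ j → A i (suc j) * c′ j) + (- A i zero) * σ
      ≡⟨ eliminated i′ ⟩
    0ℚ ∎
    where open +-*-Solver

-- `r` is the time at which a decreasing coordinate `x` reaches zero when moving along `c`. The
-- default `0ℚ` for the other coordinates makes it a function on all indices, as `extremum` asks.
ratio : ∀ x c → 0ℚ ≤ℚ x → ∃[ r ] 0ℚ ≤ℚ r × (c <ℚ 0ℚ → x + r * c ≡ 0ℚ)
ratio x c 0≤x with c ℚP.<? 0ℚ
... | no c≮0 = 0ℚ , ℚP.≤-refl , λ c<0 → contradiction c<0 c≮0
... | yes c<0 = x * 1/ (- c) , *-nonneg 0≤x 0≤1/ , λ _ → begin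
    x + x * 1/ (- c) * c
      ≡⟨ solve 3 (λ x i c → x :+ x :* i :* c := x :- x :* (i :* (:- c))) refl x (1/ (- c)) c ⟩
    x - x * (1/ (- c) * - c)  ≡⟨ cong (λ u → x - x * u) (ℚP.*-inverseˡ (- c)) ⟩
    x - x * 1ℚ                ≡⟨ solve 1 (λ x → x :- x :* con 1ℚ := con 0ℚ) refl x ⟩
    0ℚ ∎
  where
  open ≡-Reasoning
  open +-*-Solver
  instance
    c-pos : ℚ.Positive (- c)
    c-pos = ℚ.positive (ℚP.neg-antimono-< c<0)
    c-nonzero : ℚ.NonZero (- c)
    c-nonzero = ℚP.pos⇒nonZero (- c)
  0≤1/ : 0ℚ ≤ℚ 1/ (- c)
  0≤1/ = ℚP.<⇒≤ (ℚP.positive⁻¹ (1/ (- c)) {{ℚP.1/pos⇒pos (- c)}})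

-- The ratio test of the simplex method: stopping at the least ratio among the decreasing
-- coordinates makes one of them vanish before any turns negative. The others do not decrease, as
-- `t` is nonnegative.
shift-to-boundary : ∀ {k} (x c : Fin k → ℚ) → (∀ j → 0ℚ ≤ℚ x j) → (∃[ j ] c j <ℚ 0ℚ) →
                    ∃[ t ] (∀ j → 0ℚ ≤ℚ x j + t * c j) × ∃[ i ] x i + t * c i ≡ 0ℚ
shift-to-boundary x c 0≤x neg
  with i , ci<0 , least ← extremum ℚP.≤-refl ℚP.≤-trans ℚP.≤-total (λ j → proj₁ (ratio (x j) (c j) (0≤x j)))
                                   (λ j → c j ℚP.<? 0ℚ) neg
  = t , bound , i , proj₂ (proj₂ (ratio (x i) (c i) (0≤x i))) ci<0
  where
  t = proj₁ (ratio (x i) (c i) (0≤x i))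
  bound : ∀ j → 0ℚ ≤ℚ x j + t * c j
  bound j with c j ℚP.<? 0ℚ
  ... | yes cj<0 = begin
      0ℚ             ≡⟨ proj₂ (proj₂ rj) cj<0 ⟨
      x j + proj₁ rj * c j
        ≤⟨ ℚP.+-monoʳ-≤ (x j) (ℚP.*-monoʳ-≤-nonPos (c j) {{ℚ.nonPositive (ℚP.<⇒≤ cj<0)}} (least j cj<0)) ⟩
      x j + t * c j  ∎
    where
    open ℚP.≤-Reasoning
    rj = ratio (x j) (c j) (0≤x j)
  ... | no cj≮0 = subst (_≤ℚ x j + t * c j) (ℚP.+-identityˡ 0ℚ)
      (ℚP.+-mono-≤ (0≤x j) (*-nonneg (proj₁ (proj₂ (ratio (x i) (c i) (0≤x i)))) (ℚP.≮⇒≥ cj≮0)))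

-- Weighted degrees and matchings of indexed edge families.

×-mono : ∀ {m n q} → 0ℚ ≤ℚ q → m ≤ n → (m ×ℚ q) ≤ℚ (n ×ℚ q)
×-mono {n = zero}  0≤q z≤n = ℚP.≤-refl
×-mono {n = suc n} {q} 0≤q z≤n =
  subst (_≤ℚ suc n ×ℚ q) (ℚP.+-identityˡ 0ℚ) (ℚP.+-mono-≤ 0≤q (×-mono {n = n} 0≤q z≤n))
×-mono {q = q} 0≤q (s≤s m≤n) = ℚP.+-monoʳ-≤ q (×-mono 0≤q m≤n)

count-× : ∀ {k} (b : Fin k → Bool) q →
          sum (λ j → if b j then q else 0ℚ) ≡ ℕSum.sum (λ j → if b j then 1 else 0) ×ℚ q
count-× {zero}  b q = refl
count-× {suc k} b q with b zero
... | true  = cong (q +_) (count-× (b ∘ suc) q)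
... | false = trans (ℚP.+-identityˡ _) (count-× (b ∘ suc) q)

sum-supported-at : ∀ {n} (f : Fin n → ℚ) w → (∀ v → v ≢ w → f v ≡ 0ℚ) → sum f ≡ f w
sum-supported-at f w f≡0 = trans (sum-cong-≗ pointwise) (sum-at w (f w))
  where
  pointwise : ∀ v → f v ≡ (if does (w ≟ v) then f w else 0ℚ)
  pointwise v with w ≟ v
  ... | yes refl = refl
  ... | no w≢v   = f≡0 v (w≢v ∘ sym)

wdeg : ∀ {n k} → (Fin k → Edge n) → (Fin k → ℚ) → Fin 3 → Fin n → ℚ
wdeg S x t v = sum (λ j → if does (vertexIn t (S j) ≟ v) then x j else 0ℚ)

count : ∀ {n k} → (Fin k → Edge n) → Fin 3 → Fin n → ℕ
count S t v = ℕSum.sum (λ j → if does (vertexIn t (S j) ≟ v) then 1 else 0)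

-- Opaque, so that it stays recognisable to with-abstraction.
opaque
  disjoint? : ∀ {n} (e e′ : Edge n) → Dec (Disjoint e e′)
  disjoint? e e′ = all? (λ t → ¬? (vertexIn t e ≟ vertexIn t e′))

Matching : ∀ {n} → (Edge n → Set) → ℕ → Set
Matching {n} P m = Σ (Fin m → Edge n) λ M → (∀ i → P (M i)) × (∀ i j → i ≢ j → Disjoint (M i) (M j))

extend-matching : ∀ {n} {P : Edge n → Set} e → P e → ∀ {m} →
                  Matching (λ e′ → P e′ × Disjoint e e′) m → Matching P (suc m)
extend-matching {n} {P} e Pe {m} (M , inP , disj) = M′ , inP′ , disj′
  where
  M′ : Fin (suc m) → Edge n
  M′ zero    = e
  M′ (suc i) = M i
  inP′ : ∀ i → P (M′ i)
  inP′ zero    = Pe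
  inP′ (suc i) = proj₁ (inP i)
  disj′ : ∀ i j → i ≢ j → Disjoint (M′ i) (M′ j)
  disj′ zero    zero    i≢j   = contradiction refl i≢j
  disj′ zero    (suc j) _     = proj₂ (inP j)
  disj′ (suc i) zero    _   t = proj₂ (inP i) t ∘ sym
  disj′ (suc i) (suc j) i≢j   = disj i j (i≢j ∘ cong suc)

-- In the induction `P` stands for membership in the hypergraph together with disjointness from the
-- edges chosen so far. It is asked only where the weight is nonzero, so that discarding edges can
-- mean setting weights to zero. An upper bound on the degrees survives this; equality would not.
record Feasible {n k} (P : Edge n → Set) (D : ℚ) (S : Fin k → Edge n) (x : Fin k → ℚ) : Set where
  field
    nonneg  : ∀ j → 0ℚ ≤ℚ x j
    support : ∀ j → x j ≢ 0ℚ → P (S j)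
    bounded : ∀ t v → wdeg S x t v ≤ℚ D

-- The weight meeting a given edge.

module _ {n k} (S : Fin k → Edge n) (x : Fin k → ℚ) where

  -- The weight is split between the edges meeting `S i`, itself included, and those disjoint from
  -- it. Both parts keep the index set, with zeros filled in.
  near far : Fin k → Fin k → ℚ
  near i j = if does (disjoint? (S i) (S j)) then 0ℚ else x j
  far  i j = if does (disjoint? (S i) (S j)) then x j else 0ℚ

  near+far : ∀ i → sum (near i) + sum (far i) ≡ sum x
  near+far i = trans (sym (∑-distrib-+ (near i) (far i))) (sum-cong-≗ pointwise)
    where
    pointwise : ∀ j → near i j + far i j ≡ x j
    pointwise j with does (disjoint? (S i) (S j))
    ... | true  = ℚP.+-identityˡ (x j)
    ... | false = ℚP.+-identityʳ (x j)

  -- S i itself is counted once by near and three times by the degrees.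
  near-bound : (∀ j → 0ℚ ≤ℚ x j) → ∀ i →
               sum (near i) + (x i + x i) ≤ℚ sum (λ t → wdeg S x t (vertexIn t (S i)))
  near-bound 0≤x i = begin
    sum (near i) + (x i + x i)
      ≡⟨ cong (sum (near i) +_) (sum-at i (x i + x i)) ⟨
    sum (near i) + sum (λ j → if does (i ≟ j) then x i + x i else 0ℚ)
      ≡⟨ ∑-distrib-+ (near i) (λ j → if does (i ≟ j) then x i + x i else 0ℚ) ⟨
    sum (λ j → near i j + (if does (i ≟ j) then x i + x i else 0ℚ))
      ≤⟨ sum-mono pointwise ⟩
    sum (λ j → sum (λ t → common t j))
      ≡⟨ ℚSum.∑-comm (λ j t → common t j) ⟩
    sum (λ t → wdeg S x t (vertexIn t (S i))) ∎
    where
    open ℚP.≤-Reasoning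
    common : Fin 3 → Fin k → ℚ
    common t j = if does (vertexIn t (S j) ≟ vertexIn t (S i)) then x j else 0ℚ
    0≤common : ∀ j t → 0ℚ ≤ℚ common t j
    0≤common j t = if-nonneg (does (vertexIn t (S j) ≟ vertexIn t (S i))) (0≤x j)
    common≡ : ∀ {t j} → vertexIn t (S j) ≡ vertexIn t (S i) → common t j ≡ x j
    common≡ {t} {j} eq = cong (if_then x j else 0ℚ) (dec-true (vertexIn t (S j) ≟ vertexIn t (S i)) eq)
    near≤ : ∀ j → near i j ≤ℚ x j
    near≤ j with does (disjoint? (S i) (S j))
    ... | true  = 0≤x j
    ... | false = ℚP.≤-refl
    pointwise : ∀ j → near i j + (if does (i ≟ j) then x i + x i else 0ℚ) ≤ℚ sum (λ t → common t j)
    pointwise j with i ≟ j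
    ... | yes refl = begin
      near i i + (x i + x i)  ≤⟨ ℚP.+-monoˡ-≤ (x i + x i) (near≤ i) ⟩
      x i + (x i + x i)       ≡⟨ cong (λ u → x i + (x i + u)) (ℚP.+-identityʳ (x i)) ⟨
      sum {3} (λ _ → x i)     ≡⟨ sum-cong-≗ (λ t → common≡ {t} {i} refl) ⟨
      sum (λ t → common t i)  ∎
    ... | no _ with disjoint? (S i) (S j)
    ...   | yes _ = sum-nonneg (0≤common j)
    ...   | no meet with t , ¬≢ ← ¬∀⟶∃¬ 3 _ (λ t → ¬? (vertexIn t (S i) ≟ vertexIn t (S j))) meet = begin
      x j + 0ℚ                ≡⟨ ℚP.+-identityʳ (x j) ⟩
      x j                     ≡⟨ common≡ {t} (sym (decidable-stable (vertexIn t (S i) ≟ vertexIn t (S j)) ¬≢)) ⟨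
      common t j              ≤⟨ term≤sum (0≤common j) t ⟩
      sum (λ t → common t j)  ∎

  -- At most two edges pass through the vertex, none heavier than `S i`, so its degree is at most
  -- `x i + x i`. This cancels the surplus in `near-bound`, and the other two sides contribute at
  -- most `D` each.
  light-neighbourhood : ∀ {D} → (∀ j → 0ℚ ≤ℚ x j) → (∀ t v → wdeg S x t v ≤ℚ D) →
    ∀ t i → (∀ j → vertexIn t (S j) ≡ vertexIn t (S i) → x j ≤ℚ x i) →
    count S t (vertexIn t (S i)) ≤ 2 → sum (near i) ≤ℚ D + D
  light-neighbourhood {D} 0≤x deg≤D t i heaviest few = ℚP.≤-trans
    (ℚP.≤-reflexive (solve 2 (λ s y → s := s :+ y :- y) refl (sum (near i)) (x i + x i)))
    (ℚP.≤-trans (ℚP.+-monoˡ-≤ (- (x i + x i)) total)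
    (ℚP.≤-reflexive (solve 2 (λ y d → (y :+ y) :+ (d :+ d) :- (y :+ y) := d :+ d) refl (x i) D)))
    where
    open +-*-Solver
    open ℚP.≤-Reasoning
    w : Fin 3 → ℚ
    w s = wdeg S x s (vertexIn s (S i))
    at-t : w t ≤ℚ x i + x i
    at-t = begin
      w t
        ≤⟨ sum-mono (λ j → if-mono (vertexIn t (S j) ≟ vertexIn t (S i)) (heaviest j)) ⟩
      sum (λ j → if does (vertexIn t (S j) ≟ vertexIn t (S i)) then x i else 0ℚ)
        ≡⟨ count-× (λ j → does (vertexIn t (S j) ≟ vertexIn t (S i))) (x i) ⟩
      count S t (vertexIn t (S i)) ×ℚ x i
        ≤⟨ ×-mono (0≤x i) few ⟩
      x i + (x i + 0ℚ)
        ≡⟨ cong (x i +_) (ℚP.+-identityʳ (x i)) ⟩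
      x i + x i ∎
    total : sum (near i) + (x i + x i) ≤ℚ (x i + x i) + (D + D)
    total = begin
      sum (near i) + (x i + x i)        ≤⟨ near-bound 0≤x i ⟩
      sum w                             ≡⟨ sum-remove {i = t} w ⟩
      w t + sum (w ∘ punchIn t)         ≤⟨ ℚP.+-mono-≤ at-t (sum-mono {f = w ∘ punchIn t} (λ s → deg≤D (punchIn t s) (vertexIn (punchIn t s) (S i)))) ⟩
      (x i + x i) + sum {2} (λ _ → D)   ≡⟨ cong (λ u → (x i + x i) + (D + u)) (ℚP.+-identityʳ D) ⟩
      (x i + x i) + (D + D)             ∎

  heavy-neighbourhoods⇒3≤count : ∀ {D} → (∀ j → 0ℚ ≤ℚ x j) → (∀ t v → wdeg S x t v ≤ℚ D) →
    (∀ i → ¬ (sum (near i) ≤ℚ D + D)) → ∀ t i → 3 ≤ count S t (vertexIn t (S i))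
  heavy-neighbourhoods⇒3≤count 0≤x deg≤D heavy t i₀
    with i , at , heaviest ← extremum {_≼_ = flip _≤ℚ_} ℚP.≤-refl (flip ℚP.≤-trans) (flip ℚP.≤-total) x
                               (λ j → vertexIn t (S j) ≟ vertexIn t (S i₀)) (i₀ , refl)
    = ℕP.≰⇒> λ few → heavy i (light-neighbourhood 0≤x deg≤D t i (λ j eq → heaviest j (trans eq at))
                                (subst (λ v → count S t v ≤ 2) (sym at) few))

-- A perturbation that preserves all degrees.

filter-tabulate-≤-sum : ∀ {n} {A : Set} {P : Pred A 0ℓ} (P? : Decidable P) {q} (d : A → ℕ) → (∀ {a} → P a → q ≤ d a) →
  (g : Fin n → A) → q ℕ.* length (filter P? (tabulate g)) ≤ ℕSum.sum (d ∘ g)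
filter-tabulate-≤-sum {zero}  P? {q} d q≤d g = ℕP.≤-reflexive (ℕP.*-zeroʳ q)
filter-tabulate-≤-sum {suc n} P? {q} d q≤d g with P? (g zero)
... | yes Pg = ℕP.≤-trans (ℕP.≤-reflexive (ℕP.*-suc q _)) (ℕP.+-mono-≤ (q≤d Pg) (filter-tabulate-≤-sum P? d q≤d (g ∘ suc)))
... | no _   = ℕP.≤-trans (filter-tabulate-≤-sum P? d q≤d (g ∘ suc)) (ℕP.m≤n+m (ℕSum.sum (d ∘ g ∘ suc)) (d (g zero)))

-- Strictness comes from the one equation dropped on the first side; otherwise there could be as
-- many equations as edges.
three-thirds : ∀ {a a′ b c k} → a′ ℕ.< a → 3 ℕ.* a ≤ k → 3 ℕ.* b ≤ k → 3 ℕ.* c ≤ k →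
               a′ ℕ.+ (b ℕ.+ c) ℕ.< k
three-thirds {a} {a′} {b} {c} {k} a′<a 3a≤k 3b≤k 3c≤k = ℕP.*-cancelˡ-< 3 _ _ (begin-strict
  3 ℕ.* (a′ ℕ.+ (b ℕ.+ c))             <⟨ ℕP.*-monoʳ-< 3 (ℕP.+-monoˡ-< (b ℕ.+ c) a′<a) ⟩
  3 ℕ.* (a ℕ.+ (b ℕ.+ c))
    ≡⟨ trans (ℕP.*-distribˡ-+ 3 a (b ℕ.+ c)) (cong (3 ℕ.* a ℕ.+_) (ℕP.*-distribˡ-+ 3 b c)) ⟩
  3 ℕ.* a ℕ.+ (3 ℕ.* b ℕ.+ 3 ℕ.* c)   ≤⟨ ℕP.+-mono-≤ 3a≤k (ℕP.+-mono-≤ 3b≤k 3c≤k) ⟩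
  k ℕ.+ (k ℕ.+ k)                      ≡⟨ cong (λ u → k ℕ.+ (k ℕ.+ u)) (ℕP.+-identityʳ k) ⟨
  3 ℕ.* k                              ∎)
  where open ℕP.≤-Reasoning

module _ {n k} (S : Fin (suc k) → Edge n) (dense : ∀ t i → 3 ≤ count S t (vertexIn t (S i))) where

  private
    -- By `dense` these are exactly the vertices on some edge; the degree equation at any other
    -- vertex has only zero terms.
    touched : Fin 3 → List (Fin n)
    touched t = filter (λ v → 3 ℕ.≤? count S t v) (allFin n)

    v₀ : Fin n
    v₀ = vertexIn zero (S zero)

    touched∖v₀ : List (Fin n)
    touched∖v₀ = filter (λ v → ¬? (v ≟ v₀)) (touched zero)

    -- The equation at v₀ is omitted, as it follows from the others:
    -- the degrees on each side have the same sum.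
    rows : List (Fin 3 × Fin n)
    rows = map (zero ,_) touched∖v₀ ++ (map (suc zero ,_) (touched (suc zero)) ++
                                        map (suc (suc zero) ,_) (touched (suc (suc zero))))

    touched-length : ∀ t → 3 ℕ.* length (touched t) ≤ suc k
    touched-length t = ℕP.≤-trans (filter-tabulate-≤-sum (λ v → 3 ℕ.≤? count S t v) (count S t) id id) (ℕP.≤-reflexive
      (trans (FibreSum.sum-fibres ℕP.+-0-commutativeMonoid (vertexIn t ∘ S) (λ _ → 1)) (sum-ones (suc k))))
      where
      sum-ones : ∀ k → ℕSum.sum {k} (λ _ → 1) ≡ k
      sum-ones zero    = refl
      sum-ones (suc k) = cong suc (sum-ones k)

    touched∖v₀-length : length touched∖v₀ ℕ.< length (touched zero)
    touched∖v₀-length = filter-notAll (λ v → ¬? (v ≟ v₀)) (touched zero)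
      (lose (∈-filter⁺ (λ v → 3 ℕ.≤? count S zero v) (∈-allFin v₀) (dense zero zero)) (λ ¬≡ → ¬≡ refl))

    rows-length : length rows ℕ.< suc k
    rows-length = subst (ℕ._< suc k) (sym lengths)
      (three-thirds {b = length (touched (suc zero))} {c = length (touched (suc (suc zero)))} touched∖v₀-length
        (touched-length zero) (touched-length (suc zero)) (touched-length (suc (suc zero))))
      where
      lengths : length rows ≡ length touched∖v₀ ℕ.+ (length (touched (suc zero)) ℕ.+ length (touched (suc (suc zero))))
      lengths = trans (length-++ (map (zero ,_) touched∖v₀)) (cong₂ ℕ._+_ (length-map _ touched∖v₀)
        (trans (length-++ (map (suc zero ,_) (touched (suc zero))))
               (cong₂ ℕ._+_ (length-map _ (touched (suc zero))) (length-map _ (touched (suc (suc zero)))))))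

  -- A kernel vector of the degree equations in `rows`, of which there are fewer than edges. The
  -- equation at `v₀` is recovered afterwards from the total.
  degree-preserving-direction : Σ (Fin (suc k) → ℚ) λ c →
    (∃[ j ] c j <ℚ 0ℚ) × (∀ t v → wdeg S c t v ≡ 0ℚ) × sum c ≡ 0ℚ
  degree-preserving-direction
    with c , (j₀ , cj₀≢0) , solves ← kernel-vector (suc k) (length rows)
           (λ i j → if does (vertexIn (proj₁ (lookup rows i)) (S j) ≟ proj₂ (lookup rows i)) then 1ℚ else 0ℚ)
           rows-length
    = c , negative , degrees , total
    where
    in-rows : ∀ {t v} → (t , v) ∈ rows → wdeg S c t v ≡ 0ℚ
    in-rows {t} {v} mem = trans
      (cong (λ r → wdeg S c (proj₁ r) (proj₂ r)) (lookup-index mem))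
      (trans (sum-cong-≗ (λ j → sym (if-* (does (vertexIn (proj₁ r) (S j) ≟ proj₂ r)) (c j)))) (solves (index mem)))
      where r = lookup rows (index mem)

    untouched : ∀ t v → ¬ (3 ≤ count S t v) → wdeg S c t v ≡ 0ℚ
    untouched t v few = trans (sum-cong-≗ pointwise) (sum-replicate-zero (suc k))
      where
      pointwise : ∀ j → (if does (vertexIn t (S j) ≟ v) then c j else 0ℚ) ≡ 0ℚ
      pointwise j with vertexIn t (S j) ≟ v
      ... | yes refl = contradiction (dense t j) few
      ... | no _     = refl

    ∈-touched : ∀ t {v} → 3 ≤ count S t v → v ∈ touched t
    ∈-touched t {v} = ∈-filter⁺ (λ v → 3 ℕ.≤? count S t v) (∈-allFin v)

    degrees′ : ∀ t v → t ≢ zero ⊎ v ≢ v₀ → wdeg S c t v ≡ 0ℚ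
    degrees′ t v ok with 3 ℕ.≤? count S t v
    ... | no few = untouched t v few
    degrees′ zero v (inj₁ 0≢0) | yes many = contradiction refl 0≢0
    degrees′ zero v (inj₂ v≢v₀) | yes many =
      in-rows (∈-++⁺ˡ (∈-map⁺ (zero ,_) (∈-filter⁺ (λ v → ¬? (v ≟ v₀)) (∈-touched zero many) v≢v₀)))
    degrees′ (suc zero) v _ | yes many =
      in-rows (∈-++⁺ʳ (map (zero ,_) touched∖v₀) (∈-++⁺ˡ (∈-map⁺ (suc zero ,_) (∈-touched (suc zero) many))))
    degrees′ (suc (suc zero)) v _ | yes many =
      in-rows (∈-++⁺ʳ (map (zero ,_) touched∖v₀) (∈-++⁺ʳ (map (suc zero ,_) (touched (suc zero)))
        (∈-map⁺ (suc (suc zero) ,_) (∈-touched (suc (suc zero)) many))))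

    total : sum c ≡ 0ℚ
    -- The second side has all its equations, so its degree sum, which is the total, vanishes.
    total = trans (sym (sum-fibres (vertexIn (suc zero) ∘ S) c))
      (trans (sum-cong-≗ (λ v → degrees′ (suc zero) v (inj₁ λ ()))) (sum-replicate-zero n))

    degrees : ∀ t v → wdeg S c t v ≡ 0ℚ
    degrees (suc t) v = degrees′ (suc t) v (inj₁ λ ())
    degrees zero v with v ≟ v₀
    ... | no v≢v₀  = degrees′ zero v (inj₂ v≢v₀)
    ... | yes refl = begin
      -- `v₀` carries the whole degree sum of its side, which is again the total.
      wdeg S c zero v₀     ≡⟨ sum-supported-at (wdeg S c zero) v₀ (λ v v≢v₀ → degrees′ zero v (inj₂ v≢v₀)) ⟨
      sum (wdeg S c zero)  ≡⟨ sum-fibres (vertexIn zero ∘ S) c ⟩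
      sum c                ≡⟨ total ⟩
      0ℚ                   ∎
      where open ≡-Reasoning

    negative : ∃[ j ] c j <ℚ 0ℚ
    -- A nonnegative vector with zero sum would be zero, but `c j₀` is not.
    negative with any? (λ j → c j ℚP.<? 0ℚ)
    ... | yes neg = neg
    ... | no none = contradiction
      (ℚP.≤-antisym (subst (c j₀ ≤ℚ_) total (term≤sum 0≤c j₀)) (0≤c j₀)) cj₀≢0
      where
      0≤c : ∀ j → 0ℚ ≤ℚ c j
      0≤c j = ℚP.≮⇒≥ (λ cj<0 → none (j , cj<0))

-- The induction on the number of edges.

+-*-zero : ∀ p r {q} → q ≡ 0ℚ → p + r * q ≡ p
+-*-zero p r refl = trans (cong (p +_) (ℚP.*-zeroʳ r)) (ℚP.+-identityʳ p)

wdeg-linear : ∀ {n k} (S : Fin k → Edge n) x c r t v →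
              wdeg S (λ j → x j + r * c j) t v ≡ wdeg S x t v + r * wdeg S c t v
wdeg-linear S x c r t v = trans
  (sum-cong-≗ (λ j → if-linear (does (vertexIn t (S j) ≟ v)) (x j) r (c j)))
  (sum-linear (λ j → if does (vertexIn t (S j) ≟ v) then x j else 0ℚ) _ r)

drop-feasible : ∀ {n k P D} {S : Fin (suc k) → Edge n} {x} → Feasible P D S x →
                ∀ i → x i ≡ 0ℚ → Feasible P D (S ∘ punchIn i) (x ∘ punchIn i)
drop-feasible {S = S} {x} F i xi≡0 = record
  { nonneg  = nonneg ∘ punchIn i
  ; support = support ∘ punchIn i
  ; bounded = λ t v → subst (_≤ℚ _) (sym (sum-drop-zero
      (λ j → if does (vertexIn t (S j) ≟ v) then x j else 0ℚ) i (if-zero (does (vertexIn t (S i) ≟ v)) xi≡0)))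
      (bounded t v)
  }
  where open Feasible F

far-feasible : ∀ {n k P D} {S : Fin k → Edge n} {x} → Feasible P D S x →
               ∀ i → Feasible (λ e → P e × Disjoint (S i) e) D S (far S x i)
far-feasible {S = S} {x} F i = record
  { nonneg  = λ j → if-nonneg (does (disjoint? (S i) (S j))) (nonneg j)
  ; support = support′
  ; bounded = λ t v → ℚP.≤-trans
      (sum-mono (λ j → if-mono (vertexIn t (S j) ≟ v) (λ _ → far≤ j))) (bounded t v)
  }
  where
  open Feasible F
  far≤ : ∀ j → far S x i j ≤ℚ x j
  far≤ j with does (disjoint? (S i) (S j))
  ... | true  = ℚP.≤-refl
  ... | false = nonneg j
  support′ : ∀ j → far S x i j ≢ 0ℚ → _
  support′ j far≢0 with disjoint? (S i) (S j)
  ... | yes disj = support j far≢0 , disj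
  ... | no _     = contradiction refl far≢0

shift-feasible : ∀ {n k P D} {S : Fin k → Edge n} {x} → Feasible P D S x → (∀ j → P (S j)) →
  ∀ c r → (∀ j → 0ℚ ≤ℚ x j + r * c j) → (∀ t v → wdeg S c t v ≡ 0ℚ) →
  Feasible P D S (λ j → x j + r * c j)
shift-feasible {D = D} {S} {x} F inP c r 0≤x′ degrees = record
  { nonneg  = 0≤x′
  ; support = λ j _ → inP j
  ; bounded = λ t v → subst (_≤ℚ D) (sym (unchanged t v)) (Feasible.bounded F t v)
  }
  where
  unchanged : ∀ t v → wdeg S (λ j → x j + r * c j) t v ≡ wdeg S x t v
  unchanged t v = trans (wdeg-linear S x c r t v) (+-*-zero _ r (degrees t v))

-- The chosen edge uses up at most `D + D` of the weight, hence two units of `m`. One matching edge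
-- per two units is the source of the half.
far-weight : ∀ {n k} (S : Fin k → Edge n) x {D} m i → sum (near S x i) ≤ℚ D + D →
             (suc (suc m) ×ℚ D) ≤ℚ sum x → (m ×ℚ D) ≤ℚ sum (far S x i)
far-weight S x {D} m i light enough = begin
  m ×ℚ D
    ≡⟨ solve 2 (λ d q → q := (d :+ (d :+ q)) :- (d :+ d)) refl D (m ×ℚ D) ⟩
  (suc (suc m) ×ℚ D) - (D + D)
    ≤⟨ ℚP.+-mono-≤ enough (ℚP.neg-antimono-≤ light) ⟩
  sum x - sum (near S x i)
    ≡⟨ cong (_- sum (near S x i)) (near+far S x i) ⟨
  (sum (near S x i) + sum (far S x i)) - sum (near S x i)
    ≡⟨ solve 2 (λ a b → (a :+ b) :- a := b) refl (sum (near S x i)) (sum (far S x i)) ⟩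
  sum (far S x i) ∎
  where
  open +-*-Solver
  open ℚP.≤-Reasoning

-- An edge meets itself. This index of weight zero lets the recursion pass to a smaller family after
-- `S i` is chosen.
far-self : ∀ {n k} (S : Fin k → Edge n) x i → far S x i i ≡ 0ℚ
far-self S x i = cong (if_then x i else 0ℚ) (dec-false (disjoint? (S i) (S i)) (λ disj → disj zero refl))

-- Every recursive case ends by deleting an index of weight zero: one already present, the chosen
-- edge after passing to `far`, or the coordinate that a perturbation brings to zero. `P` varies in
-- the recursion, as choosing an edge strengthens it.
matching-from-weights : ∀ {n} k m {P : Edge n → Set} {D} (S : Fin k → Edge n) x → 0ℚ <ℚ D →
  Feasible P D S x → (m ×ℚ D) ≤ℚ sum x → Matching P ⌈ m /2⌉
matching-from-weights k zero S x 0<D F enough = (λ ()) , (λ ()) , λ ()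
matching-from-weights zero (suc m) {D = D} S x 0<D F enough =
  contradiction (ℚP.<-≤-trans 0<D (ℚP.≤-trans D≤ enough)) (ℚP.<-irrefl refl)
  where
  D≤ : D ≤ℚ suc m ×ℚ D
  D≤ = subst (_≤ℚ suc m ×ℚ D) (ℚP.+-identityʳ D) (×-mono {1} {suc m} (ℚP.<⇒≤ 0<D) (s≤s z≤n))
matching-from-weights {n} (suc k) (suc m) {P} {D} S x 0<D F enough =
  case any? (λ i → x i ℚP.≟ 0ℚ) of λ where
    (yes (i , xi≡0)) → drop-and-recurse (suc m) x F enough i xi≡0
    -- No weight is zero, so every edge satisfies `P`, and a perturbation cannot put weight outside
    -- `P`.
    (no x≢0) → let inP = λ j → Feasible.support F j (λ xj≡0 → x≢0 (j , xj≡0)) in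
      case any? (λ i → sum (near S x i) ℚP.≤? (D + D)) of λ where
        (yes (i , light)) → extend i light (inP i) m enough
        (no heavy)        → perturb (λ i light → heavy (i , light)) inP
  where
  drop-and-recurse : ∀ m {P} x → Feasible P D S x → (m ×ℚ D) ≤ℚ sum x →
                     ∀ i → x i ≡ 0ℚ → Matching P ⌈ m /2⌉
  drop-and-recurse m x F enough i xi≡0 =
    matching-from-weights k m (S ∘ punchIn i) (x ∘ punchIn i) 0<D (drop-feasible F i xi≡0)
      (subst ((m ×ℚ D) ≤ℚ_) (sym (sum-drop-zero x i xi≡0)) enough)

  extend : ∀ i → sum (near S x i) ≤ℚ D + D → P (S i) → ∀ m → (suc m ×ℚ D) ≤ℚ sum x → Matching P ⌈ suc m /2⌉
  -- Here `⌈ 1 /2⌉` is 1, so `S i` alone suffices and the remaining demand is zero.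
  extend i light Pi zero _ =
    extend-matching {P = P} (S i) Pi (drop-and-recurse zero (far S x i) (far-feasible F i)
      (sum-nonneg (Feasible.nonneg (far-feasible F i))) i (far-self S x i))
  extend i light Pi (suc m) enough =
    extend-matching {P = P} (S i) Pi (drop-and-recurse m (far S x i) (far-feasible F i)
      (far-weight S x m i light enough) i (far-self S x i))

  perturb : (∀ i → ¬ (sum (near S x i) ≤ℚ D + D)) → (∀ j → P (S j)) → Matching P ⌈ suc m /2⌉
  perturb heavy inP =
    let c , neg , degrees , total = degree-preserving-direction S
          (heavy-neighbourhoods⇒3≤count S x (Feasible.nonneg F) (Feasible.bounded F) heavy)
        r , 0≤x′ , i , x′i≡0 = shift-to-boundary x c (Feasible.nonneg F) neg
    in drop-and-recurse (suc m) (λ j → x j + r * c j) (shift-feasible F inP c r 0≤x′ degrees)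
         (subst ((suc m ×ℚ D) ≤ℚ_) (sym (trans (sum-linear x c r) (+-*-zero (sum x) r total))) enough) i x′i≡0

-- From balanced weightings to indexed edge families.

sumℚ-++ : ∀ xs ys → sumℚ (xs ++ ys) ≡ sumℚ xs + sumℚ ys
sumℚ-++ []       ys = sym (ℚP.+-identityˡ _)
sumℚ-++ (x ∷ xs) ys = trans (cong (x +_) (sumℚ-++ xs ys)) (sym (ℚP.+-assoc x (sumℚ xs) (sumℚ ys)))

module _ {A : Set} (g : A → ℚ) where

  sumℚ-lookup : ∀ xs → sumℚ (map g xs) ≡ sum (g ∘ lookup xs)
  sumℚ-lookup []       = refl
  sumℚ-lookup (x ∷ xs) = cong (g x +_) (sumℚ-lookup xs)

  sumℚ-tabulate : ∀ {n} (h : Fin n → A) → sumℚ (map g (tabulate h)) ≡ sum (g ∘ h)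
  sumℚ-tabulate {zero}  h = refl
  sumℚ-tabulate {suc n} h = cong (g (h zero) +_) (sumℚ-tabulate (h ∘ suc))

  sumℚ-concatMap : ∀ {B : Set} (h : B → List A) xs →
                   sumℚ (map g (concatMap h xs)) ≡ sumℚ (map (λ x → sumℚ (map g (h x))) xs)
  sumℚ-concatMap h []       = refl
  sumℚ-concatMap h (x ∷ xs) = trans (cong sumℚ (map-++ g (h x) (concatMap h xs)))
    (trans (sumℚ-++ (map g (h x)) _) (cong (sumℚ (map g (h x)) +_) (sumℚ-concatMap h xs)))

-- The helper of deg cannot be named here; in a mutual block the left-hand
-- side of deg-summand is inferred from its use.
mutual
  deg≡sumℚ : ∀ {n} (f : Edge n → ℚ) t v →
    deg f t v ≡ sumℚ (map (λ e → if does (vertexIn t e ≟ v) then f e else 0ℚ) (allEdges n))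
  deg≡sumℚ {n} f t v = cong sumℚ (map-cong (deg-summand f t v) (allEdges n))

  deg-summand : ∀ {n} (f : Edge n → ℚ) t v e → _ ≡ (if does (vertexIn t e ≟ v) then f e else 0ℚ)
  deg-summand f t v e with does (vertexIn t e ≟ v)
  ... | true  = refl
  ... | false = refl

∈-allEdges : ∀ {n} (e : Edge n) → e ∈ allEdges n
∈-allEdges (a , b , c) = ∈-concatMap⁺ _ (lose (∈-allFin a)
  (∈-concatMap⁺ _ (lose (∈-allFin b) (∈-map⁺ (λ c → a , b , c) (∈-allFin c)))))

×-mono-< : ∀ n {p q} → p <ℚ q → (suc n ×ℚ p) <ℚ (suc n ×ℚ q)
×-mono-< zero    p<q = ℚP.+-mono-<-≤ p<q ℚP.≤-refl
×-mono-< (suc n) p<q = ℚP.+-mono-< p<q (×-mono-< n p<q)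

-- All triples serve as the indexed family, those outside `H` with weight zero. The first side has
-- `suc n` vertices of degree `D`, so the total is exactly the `suc n ×ℚ D` that
-- `matching-from-weights` asks for.
balanced⇒matching : ∀ n → AllHaveMatching (suc n) ⌈ suc n /2⌉
balanced⇒matching n H (f , (0≤f , f-off-H) , balanced , e₀ , fe₀≢0) =
  matching-from-weights (length (allEdges (suc n))) (suc n) S x 0<D feasible (ℚP.≤-reflexive (side-total zero))
  where
  S : Fin (length (allEdges (suc n))) → Edge (suc n)
  S = lookup (allEdges (suc n))

  x : Fin (length (allEdges (suc n))) → ℚ
  x = f ∘ S

  D : ℚ
  D = deg f zero zero

  deg≡wdeg : ∀ t v → deg f t v ≡ wdeg S x t v
  deg≡wdeg t v = trans (deg≡sumℚ f t v)
    (sumℚ-lookup (λ e → if does (vertexIn t e ≟ v) then f e else 0ℚ) (allEdges (suc n)))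

  side-total : ∀ t → suc n ×ℚ deg f t zero ≡ sum x
  side-total t = begin
    suc n ×ℚ deg f t zero                ≡⟨ sum-replicate (suc n) {deg f t zero} ⟨
    sum {suc n} (λ _ → deg f t zero)     ≡⟨ sum-cong-≗ (λ v → trans (balanced t zero v) (deg≡wdeg t v)) ⟩
    sum (wdeg S x t)                     ≡⟨ sum-fibres (vertexIn t ∘ S) x ⟩
    sum x                                ∎
    where open ≡-Reasoning

  deg≤D : ∀ t v → deg f t v ≤ℚ D
  -- On every side `suc n` equal degrees add up to the same `sum x`, so a degree above `D` on side
  -- `t` would make that total too large.
  deg≤D t v = ℚP.≮⇒≥ λ D<deg → ℚP.<-irrefl (trans (side-total zero) (sym (side-total t)))
    (×-mono-< n (subst (D <ℚ_) (balanced t v zero) D<deg))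

  feasible : Feasible (λ e → H e ≡ true) D S x
  feasible = record
    { nonneg  = 0≤f ∘ S
    ; support = λ j → in-H (S j)
    ; bounded = λ t v → subst (_≤ℚ D) (deg≡wdeg t v) (deg≤D t v)
    }
    where
    in-H : ∀ e → f e ≢ 0ℚ → H e ≡ true
    in-H e fe≢0 with H e in eq
    ... | true  = refl
    ... | false = contradiction (f-off-H e eq) fe≢0

  0<D : 0ℚ <ℚ D
  0<D = ℚP.≰⇒> λ D≤0 → fe₀≢0 (ℚP.≤-antisym (ℚP.≤-trans fe₀≤D D≤0) (0≤f e₀))
    where
    open ℚP.≤-Reasoning
    v = vertexIn zero e₀
    j = index (∈-allEdges e₀)
    e₀≡Sj : e₀ ≡ S j
    e₀≡Sj = lookup-index (∈-allEdges e₀)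
    fe₀≤D : f e₀ ≤ℚ D
    fe₀≤D = begin
      f e₀              ≡⟨ cong f e₀≡Sj ⟩
      x j               ≡⟨ cong (if_then x j else 0ℚ) (dec-true (vertexIn zero (S j) ≟ v) (cong (vertexIn zero) (sym e₀≡Sj))) ⟨
      (if does (vertexIn zero (S j) ≟ v) then x j else 0ℚ)
                        ≤⟨ term≤sum (λ j → if-nonneg (does (vertexIn zero (S j) ≟ v)) (0≤f (S j))) j ⟩
      wdeg S x zero v   ≡⟨ deg≡wdeg zero v ⟨
      deg f zero v      ≤⟨ deg≤D zero v ⟩
      D                 ∎

-- Degrees as sums over two coordinates.

sum-zero : ∀ {k} {f : Fin k → ℚ} → (∀ j → f j ≡ 0ℚ) → sum f ≡ 0ℚ
sum-zero {k} f≡0 = trans (sum-cong-≗ f≡0) (sum-replicate-zero k)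

sumℚ-allEdges : ∀ {n} (g : Edge n → ℚ) →
                sumℚ (map g (allEdges n)) ≡ sum (λ a → sum (λ b → sum (λ c → g (a , b , c))))
sumℚ-allEdges {n} g = begin
  sumℚ (map g (allEdges n))
    ≡⟨ sumℚ-concatMap g plane (allFin n) ⟩
  sumℚ (map (λ a → sumℚ (map g (plane a))) (allFin n))
    ≡⟨ sumℚ-tabulate (λ a → sumℚ (map g (plane a))) id ⟩
  sum (λ a → sumℚ (map g (plane a)))
    ≡⟨ sum-cong-≗ (λ a → trans (sumℚ-concatMap g (line a) (allFin n))
                               (sumℚ-tabulate (λ b → sumℚ (map g (line a b))) id)) ⟩
  sum (λ a → sum (λ b → sumℚ (map g (line a b))))
    ≡⟨ sum-cong-≗ (λ a → sum-cong-≗ (λ b → trans (cong sumℚ (sym (map-∘ (allFin n))))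
                                                 (sumℚ-tabulate (λ c → g (a , b , c)) id))) ⟩
  sum (λ a → sum (λ b → sum (λ c → g (a , b , c)))) ∎
  where
  open ≡-Reasoning
  line : Fin n → Fin n → List (Edge n)
  line a b = map (λ c → a , b , c) (allFin n)
  plane : Fin n → List (Edge n)
  plane a = concatMap (line a) (allFin n)

module _ {n} (f : Edge n → ℚ) where
  private
    on : ∀ (v : Fin n) q → (if does (v ≟ v) then q else 0ℚ) ≡ q
    on v q = cong (if_then q else 0ℚ) (dec-true (v ≟ v) refl)
    off : ∀ {v w : Fin n} → v ≢ w → ∀ q → (if does (v ≟ w) then q else 0ℚ) ≡ 0ℚ
    off {v} {w} v≢w q = cong (if_then q else 0ℚ) (dec-false (v ≟ w) v≢w)

    summand : Fin 3 → Fin n → Edge n → ℚ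
    summand t v e = if does (vertexIn t e ≟ v) then f e else 0ℚ
    deg≡triple-sum : ∀ t v → deg f t v ≡ sum (λ a → sum (λ b → sum (λ c → summand t v (a , b , c))))
    deg≡triple-sum t v = trans (deg≡sumℚ f t v) (sumℚ-allEdges (summand t v))

  deg₁ : ∀ v → deg f zero v ≡ sum (λ b → sum (λ c → f (v , b , c)))
  deg₁ v = trans (deg≡triple-sum zero v) (trans
    (sum-supported-at (λ a → sum (λ b → sum (λ c → summand zero v (a , b , c)))) v
      (λ a a≢v → sum-zero (λ b → sum-zero (λ c → off a≢v (f (a , b , c))))))
    (sum-cong-≗ (λ b → sum-cong-≗ (λ c → on v (f (v , b , c))))))

  deg₂ : ∀ v → deg f (suc zero) v ≡ sum (λ a → sum (λ c → f (a , v , c)))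
  deg₂ v = trans (deg≡triple-sum (suc zero) v) (sum-cong-≗ (λ a → trans
    (sum-supported-at (λ b → sum (λ c → summand (suc zero) v (a , b , c))) v
      (λ b b≢v → sum-zero (λ c → off b≢v (f (a , b , c)))))
    (sum-cong-≗ (λ c → on v (f (a , v , c))))))

  deg₃ : ∀ v → deg f (suc (suc zero)) v ≡ sum (λ a → sum (λ b → f (a , b , v)))
  deg₃ v = trans (deg≡triple-sum (suc (suc zero)) v) (sum-cong-≗ (λ a → sum-cong-≗ (λ b → trans
    (sum-supported-at (λ c → summand (suc (suc zero)) v (a , b , c)) v (λ c c≢v → off c≢v (f (a , b , c)))) (on v (f (a , b , v))))))

-- The extremal hypergraph and its matchings.

pattern one  = suc zero
pattern ss a = suc (suc a)

-- The vertices of each side are grouped into consecutive pairs.  Each pair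
-- carries the four intersecting edges with an even number of odd vertices
-- (the truncated Fano plane); if n is odd, the last vertices form one edge.
weight : ∀ {n} → Fin n → Fin n → Fin n → ℚ
weight {1}    _      _      _       = 1ℚ + 1ℚ
weight {ss n} zero   zero   zero    = 1ℚ
weight {ss n} zero   zero   (suc _) = 0ℚ
weight {ss n} zero   one    zero    = 0ℚ
weight {ss n} zero   one    one     = 1ℚ
weight {ss n} zero   one    (ss _)  = 0ℚ
weight {ss n} zero   (ss _) _       = 0ℚ
weight {ss n} one    zero   zero    = 0ℚ
weight {ss n} one    zero   one     = 1ℚ
weight {ss n} one    zero   (ss _)  = 0ℚ
weight {ss n} one    one    zero    = 1ℚ
weight {ss n} one    one    (suc _) = 0ℚ
weight {ss n} one    (ss _) _       = 0ℚ
weight {ss n} (ss _) zero   _       = 0ℚ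
weight {ss n} (ss _) one    _       = 0ℚ
weight {ss n} (ss _) (ss _) zero    = 0ℚ
weight {ss n} (ss _) (ss _) one     = 0ℚ
weight {ss n} (ss a) (ss b) (ss c)  = weight a b c

weight-nonneg : ∀ {n} (a b c : Fin n) → 0ℚ ≤ℚ weight a b c
weight-nonneg {1}    _      _      _       = ℚP.nonNegative⁻¹ (1ℚ + 1ℚ)
weight-nonneg {ss n} zero   zero   zero    = ℚP.nonNegative⁻¹ 1ℚ
weight-nonneg {ss n} zero   zero   (suc _) = ℚP.≤-refl
weight-nonneg {ss n} zero   one    zero    = ℚP.≤-refl
weight-nonneg {ss n} zero   one    one     = ℚP.nonNegative⁻¹ 1ℚ
weight-nonneg {ss n} zero   one    (ss _)  = ℚP.≤-refl
weight-nonneg {ss n} zero   (ss _) _       = ℚP.≤-refl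
weight-nonneg {ss n} one    zero   zero    = ℚP.≤-refl
weight-nonneg {ss n} one    zero   one     = ℚP.nonNegative⁻¹ 1ℚ
weight-nonneg {ss n} one    zero   (ss _)  = ℚP.≤-refl
weight-nonneg {ss n} one    one    zero    = ℚP.nonNegative⁻¹ 1ℚ
weight-nonneg {ss n} one    one    (suc _) = ℚP.≤-refl
weight-nonneg {ss n} one    (ss _) _       = ℚP.≤-refl
weight-nonneg {ss n} (ss _) zero   _       = ℚP.≤-refl
weight-nonneg {ss n} (ss _) one    _       = ℚP.≤-refl
weight-nonneg {ss n} (ss _) (ss _) zero    = ℚP.≤-refl
weight-nonneg {ss n} (ss _) (ss _) one     = ℚP.≤-refl
weight-nonneg {ss n} (ss a) (ss b) (ss c)  = weight-nonneg a b c

module _ {n} (g : Fin (ss n) → Fin (ss n) → ℚ) where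

  first-block-sum : (∀ a b → g (ss a) b ≡ 0ℚ) → (∀ b → g zero (ss b) ≡ 0ℚ) → (∀ b → g one (ss b) ≡ 0ℚ) →
    sum (λ a → sum (g a)) ≡ (g zero zero + (g zero one + 0ℚ)) + ((g one zero + (g one one + 0ℚ)) + 0ℚ)
  first-block-sum g≡0 g₀≡0 g₁≡0 = cong₂ _+_
    (cong (λ q → g zero zero + (g zero one + q)) (sum-zero g₀≡0))
    (cong₂ _+_ (cong (λ q → g one zero + (g one one + q)) (sum-zero g₁≡0))
               (sum-zero (λ a → sum-zero (g≡0 a))))

  later-blocks-sum : (∀ b → g zero b ≡ 0ℚ) → (∀ b → g one b ≡ 0ℚ) →
    (∀ a → g (ss a) zero ≡ 0ℚ) → (∀ a → g (ss a) one ≡ 0ℚ) →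
    sum (λ a → sum (g a)) ≡ sum (λ a → sum (λ b → g (ss a) (ss b)))
  later-blocks-sum g₀≡0 g₁≡0 h₀≡0 h₁≡0 =
    trans (cancel (sum-zero g₀≡0) (sum-zero g₁≡0)) (sum-cong-≗ (λ a → cancel (h₀≡0 a) (h₁≡0 a)))
    where
    cancel : ∀ {p q r} → p ≡ 0ℚ → q ≡ 0ℚ → p + (q + r) ≡ r
    cancel refl refl = trans (ℚP.+-identityˡ _) (ℚP.+-identityˡ _)

-- A vertex of a pair lies on two of the four edges there, each of weight 1; the single last edge
-- has weight 2 to match.
weight-deg₁ : ∀ {n} (v : Fin n) → sum (λ b → sum (λ c → weight v b c)) ≡ 1ℚ + 1ℚ
weight-deg₁ {1}    zero   = refl
weight-deg₁ {ss n} zero   = first-block-sum {n} (weight zero) (λ _ _ → refl) (λ _ → refl) (λ _ → refl)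
weight-deg₁ {ss n} one    = first-block-sum {n} (weight one) (λ _ _ → refl) (λ _ → refl) (λ _ → refl)
weight-deg₁ {ss n} (ss v) = trans
  (later-blocks-sum (weight (ss v)) (λ _ → refl) (λ _ → refl) (λ _ → refl) (λ _ → refl)) (weight-deg₁ v)

weight-deg₂ : ∀ {n} (v : Fin n) → sum (λ a → sum (λ c → weight a v c)) ≡ 1ℚ + 1ℚ
weight-deg₂ {1}    zero   = refl
weight-deg₂ {ss n} zero   = first-block-sum {n} (λ a → weight a zero) (λ _ _ → refl) (λ _ → refl) (λ _ → refl)
weight-deg₂ {ss n} one    = first-block-sum {n} (λ a → weight a one) (λ _ _ → refl) (λ _ → refl) (λ _ → refl)
weight-deg₂ {ss n} (ss v) = trans
  (later-blocks-sum (λ a → weight a (ss v)) (λ _ → refl) (λ _ → refl) (λ _ → refl) (λ _ → refl)) (weight-deg₂ v)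

weight-deg₃ : ∀ {n} (v : Fin n) → sum (λ a → sum (λ b → weight a b v)) ≡ 1ℚ + 1ℚ
weight-deg₃ {1}    zero   = refl
weight-deg₃ {ss n} zero   = first-block-sum {n} (λ a b → weight a b zero)
  (λ { a zero → refl ; a one → refl ; a (ss b) → refl }) (λ _ → refl) (λ _ → refl)
weight-deg₃ {ss n} one    = first-block-sum {n} (λ a b → weight a b one)
  (λ { a zero → refl ; a one → refl ; a (ss b) → refl }) (λ _ → refl) (λ _ → refl)
weight-deg₃ {ss n} (ss v) = trans
  (later-blocks-sum (λ a b → weight a b (ss v))
    (λ { zero → refl ; one → refl ; (ss b) → refl }) (λ { zero → refl ; one → refl ; (ss b) → refl })
    (λ _ → refl) (λ _ → refl)) (weight-deg₃ v)

bit : ∀ {n} → Bool → Fin (ss n)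
bit false = zero
bit true  = one

-- The nonzero clauses of `weight`, with the four Fano edges folded into one constructor: an even
-- number of odd vertices means that the third bit is the `xor` of the other two.
data Supported : ∀ {n} → Fin n → Fin n → Fin n → Set where
  last-edge : Supported {1} zero zero zero
  fano      : ∀ {n} p q → Supported {ss n} (bit p) (bit q) (bit (p xor q))
  later     : ∀ {n} {a b c : Fin n} → Supported a b c → Supported (ss a) (ss b) (ss c)

weight-support : ∀ {n} (a b c : Fin n) → weight a b c ≢ 0ℚ → Supported a b c
weight-support {1}    zero   zero   zero    _  = last-edge
weight-support {ss n} zero   zero   zero    _  = fano false false
weight-support {ss n} zero   zero   (suc _) ≢0 = contradiction refl ≢0
weight-support {ss n} zero   one    zero    ≢0 = contradiction refl ≢0
weight-support {ss n} zero   one    one     _  = fano false true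
weight-support {ss n} zero   one    (ss _)  ≢0 = contradiction refl ≢0
weight-support {ss n} zero   (ss _) _       ≢0 = contradiction refl ≢0
weight-support {ss n} one    zero   zero    ≢0 = contradiction refl ≢0
weight-support {ss n} one    zero   one     _  = fano true false
weight-support {ss n} one    zero   (ss _)  ≢0 = contradiction refl ≢0
weight-support {ss n} one    one    zero    _  = fano true true
weight-support {ss n} one    one    (suc _) ≢0 = contradiction refl ≢0
weight-support {ss n} one    (ss _) _       ≢0 = contradiction refl ≢0
weight-support {ss n} (ss _) zero   _       ≢0 = contradiction refl ≢0
weight-support {ss n} (ss _) one    _       ≢0 = contradiction refl ≢0
weight-support {ss n} (ss _) (ss _) zero    ≢0 = contradiction refl ≢0
weight-support {ss n} (ss _) (ss _) one     ≢0 = contradiction refl ≢0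
weight-support {ss n} (ss a) (ss b) (ss c)  ≢0 = later (weight-support a b c ≢0)

-- For odd `n` the last vertex is a block of its own, which gives the rounding up.
block : ∀ {n} → Fin n → Fin ⌈ n /2⌉
block {1}    zero   = zero
block {ss n} zero   = zero
block {ss n} one    = zero
block {ss n} (ss a) = suc (block a)

-- Flipping both arguments leaves the `xor` unchanged. Hence two edges of a Fano block that differ
-- on the first two sides meet on the third.
xor-flip : ∀ {p p′ q q′} → p ≢ p′ → q ≢ q′ → p xor q ≡ p′ xor q′
xor-flip {p′ = p′} {q′ = q′} p≢p′ q≢q′ =
  trans (cong₂ _xor_ (𝔹P.¬-not p≢p′) (𝔹P.¬-not q≢q′)) (not-xor-not p′ q′)
  where
  not-xor-not : ∀ p q → not p xor not q ≡ p xor q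
  not-xor-not false q = 𝔹P.not-involutive q
  not-xor-not true  q = refl

-- Blocks are compared on the first side alone, since a supported edge has its three vertices in
-- blocks of the same index.
same-block-intersect : ∀ {n} {a b c a′ b′ c′ : Fin n} → Supported a b c → Supported a′ b′ c′ →
                       block a ≡ block a′ → ¬ Disjoint (a , b , c) (a′ , b′ , c′)
same-block-intersect last-edge last-edge _ disj = disj zero refl
same-block-intersect (fano p q) (fano p′ q′) _ disj =
  disj (ss zero) (cong bit (xor-flip (disj zero ∘ cong bit) (disj one ∘ cong bit)))
-- Splitting the bit lets `block` reduce to `zero`, which clashes with the `suc` of a later block.
same-block-intersect (fano false q) (later _) ()
same-block-intersect (fano true q) (later _) ()
same-block-intersect (later _) (fano false q) ()
same-block-intersect (later _) (fano true q) ()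
same-block-intersect (later s) (later s′) eq disj =
  same-block-intersect s s′ (suc-injective eq) λ where
    zero      → disj zero ∘ cong (λ v → ss v)
    one       → disj one ∘ cong (λ v → ss v)
    (ss zero) → disj (ss zero) ∘ cong (λ v → ss v)

weightₑ : ∀ {n} → Edge n → ℚ
weightₑ (a , b , c) = weight a b c

extremal : ∀ n → Hypergraph n
extremal n e = not (does (weightₑ e ℚP.≟ 0ℚ))

extremal-balanced : ∀ n → FractionallyBalanced (extremal (suc n))
extremal-balanced n =
  weightₑ , ((λ (a , b , c) → weight-nonneg a b c) , vanishes) ,
  (λ t v w → trans (degree t v) (sym (degree t w))) ,
  (zero , zero , zero) , nonzero n
  where
  vanishes : ∀ e → extremal (suc n) e ≡ false → weightₑ e ≡ 0ℚ
  vanishes e _ with weightₑ e ℚP.≟ 0ℚ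
  vanishes e _  | yes ≡0 = ≡0
  vanishes e () | no _
  degree : ∀ t v → deg weightₑ t v ≡ 1ℚ + 1ℚ
  degree zero      v = trans (deg₁ weightₑ v) (weight-deg₁ v)
  degree one       v = trans (deg₂ weightₑ v) (weight-deg₂ v)
  degree (ss zero) v = trans (deg₃ weightₑ v) (weight-deg₃ v)
  nonzero : ∀ n → weight {suc n} zero zero zero ≢ 0ℚ
  nonzero zero    ()
  nonzero (suc n) ()

-- Pigeonhole: disjoint edges lie in distinct blocks, and there are `⌈ n /2⌉` blocks.
extremal-matching-bound : ∀ n m → HasMatchingOfSize (extremal n) m → m ≤ ⌈ n /2⌉
extremal-matching-bound n m (M , inH , disj) = injective⇒≤ {f = block ∘ proj₁ ∘ M} injective
  where
  supported : ∀ e → extremal n e ≡ true → Supported (proj₁ e) (proj₁ (proj₂ e)) (proj₂ (proj₂ e))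
  supported e _ with weightₑ e ℚP.≟ 0ℚ
  supported e () | yes _
  supported e _  | no ≢0 = weight-support _ _ _ ≢0
  injective : ∀ {i j} → block (proj₁ (M i)) ≡ block (proj₁ (M j)) → i ≡ j
  injective {i} {j} eq = decidable-stable (i ≟ j) λ i≢j →
    same-block-intersect (supported (M i) (inH i)) (supported (M j) (inH j)) eq (disj i j i≢j)

theorem4p3 : ∀ (n : ℕ) → 1 ≤ n → IsBM n ⌈ n /2⌉
theorem4p3 (suc n) _ = balanced⇒matching n , λ m′ allHave →
  extremal-matching-bound (suc n) m′ (allHave (extremal (suc n)) (extremal-balanced n))
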